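{- Suppose the Boolean algebra $B$ is complete. Let $W$ be a CFG-space over $B$, let $U,V\subset W$ be arbitrary subsets, and let $F:U\to V$ be a contractive map. Then there is a contractive map $F':W\to W$ whose restriction to $U$ is $F$.
   Context: A Boolean metric space over a Boolean algebra $B$ is a set $X$ with a symmetric map $d:X\times X\to B$ such that $d(x,y)=0$ iff $x=y$, and $d(x,z)\le d(x,y)\vee d(y,z)$. A map is contractive if $d(f(x),f(y))\le d(x,y)$ for all $x,y$. A partition of $B$ is a finite family of pairwise disjoint elements with supremum $1$. Given $x_0,\dots,x_n\in X$ and a partition $a_0,\dots,a_n$, $x\in X$ is a convex combination of them with these coefficients if $a_i\wedge d(x,x_i)=0$ for all $i$. $X$ is convex if such a convex combination exists in $X$ for every choice of points and partition; finitely generated if some finite $S\subset X$ has every element of $X$ as a convex combination of elements of $S$. A CFG-space is a convex, finitely generated Boolean metric space. $B$ is complete if every subset of $B$ has a supremum. -}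

module Defs where

open import Data.List.Base using (List)
open import Data.List.Membership.Setoid using (_∈_)
open import Data.Nat.Base using (ℕ; suc)
open import Data.Product.Base using (Σ; ∃; _×_; proj₁)
open import Data.Vec.Functional using (Vector)
open import Function.Metric.Core using (DistanceFunction)
open import Function.Metric.Structures using (IsGeneralMetric)
open import Level using (Level; _⊔_) renaming (suc to lsuc)
open import Relation.Binary.Bundles using (Setoid)
open import Relation.Binary.Core using (Rel)
open import Relation.Binary.Lattice.Bundles using (BooleanAlgebra)
open import Relation.Binary.PropositionalEquality.Core using (_≢_)
open import Relation.Unary using (Pred)

module _ {c ℓ₁ ℓ₂} (B : BooleanAlgebra c ℓ₁ ℓ₂) where

  private module B = BooleanAlgebra B

  IsSupremum : ∀ {p} → Pred B.Carrier p → B.Carrier → Set (c ⊔ ℓ₂ ⊔ p)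
  IsSupremum P s =
    (∀ b → P b → b B.≤ s) × (∀ t → (∀ b → P b → b B.≤ t) → s B.≤ t)

  -- The subsets of B range over the predicates of one universe level p. They
  -- need not respect _≈_: a predicate and its closure under _≈_ have the same
  -- upper bounds.
  IsComplete : (p : Level) → Set (c ⊔ ℓ₂ ⊔ lsuc p)
  IsComplete p = (P : Pred B.Carrier p) → ∃ (IsSupremum P)

  record IsPartition {n} (a : Vector B.Carrier n) : Set (c ⊔ ℓ₁ ⊔ ℓ₂) where
    field
      disjoint : ∀ {i j} → i ≢ j → a i B.∧ a j B.≈ B.⊥
      supremum : IsSupremum (λ b → ∃ λ i → a i B.≈ b) B.⊤

  -- The points form a setoid. Of the laws in IsGeneralMetric beyond the usual
  -- axioms, nonNegative is automatic since ⊥ is least, and cong follows from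
  -- definiteness, symmetry and the triangle inequality.
  record BooleanMetricSpace (x ℓ : Level)
         : Set (c ⊔ ℓ₁ ⊔ ℓ₂ ⊔ lsuc (x ⊔ ℓ)) where
    infix 4 _≈_
    field
      Carrier  : Set x
      _≈_      : Rel Carrier ℓ
      d        : DistanceFunction Carrier B.Carrier
      isMetric : IsGeneralMetric _≈_ B._≈_ B._≤_ B.⊥ B._∨_ d

    open IsGeneralMetric isMetric public
      using (module EqC; cong; ≈⇒0; 0⇒≈; sym; triangle)

    setoid : Setoid x ℓ
    setoid = record { isEquivalence = IsGeneralMetric.≈-isEquivalence isMetric }

module _ {c ℓ₁ ℓ₂} {B : BooleanAlgebra c ℓ₁ ℓ₂} where

  private module B = BooleanAlgebra B

  IsContractive : ∀ {x ℓ y ℓ′}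
                  (X : BooleanMetricSpace B x ℓ) (Y : BooleanMetricSpace B y ℓ′) →
                  (BooleanMetricSpace.Carrier X → BooleanMetricSpace.Carrier Y) →
                  Set (ℓ₂ ⊔ x)
  IsContractive X Y f = ∀ p q → Y.d (f p) (f q) B.≤ X.d p q
    where
    module X = BooleanMetricSpace X
    module Y = BooleanMetricSpace Y

  -- U need not respect _≈_, and equality of elements of U ignores the proofs
  -- of membership.
  subspace : ∀ {x ℓ u} (X : BooleanMetricSpace B x ℓ) →
             Pred (BooleanMetricSpace.Carrier X) u →
             BooleanMetricSpace B (x ⊔ u) ℓ
  subspace X U = record
    { Carrier  = Σ X.Carrier U
    ; _≈_      = λ p q → proj₁ p X.≈ proj₁ q
    ; d        = λ p q → X.d (proj₁ p) (proj₁ q)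
    ; isMetric = record
      { isSemiMetric = record
        { isQuasiSemiMetric = record
          { isPreMetric = record
            { isProtoMetric = record
              { isPartialOrder  = M.isPartialOrder
              ; ≈-isEquivalence = record
                { refl = X.EqC.refl ; sym = X.EqC.sym ; trans = X.EqC.trans }
              ; cong            = X.cong
              ; nonNegative     = M.nonNegative
              }
            ; ≈⇒0 = X.≈⇒0
            }
          ; 0⇒≈ = X.0⇒≈
          }
        ; sym = λ p q → X.sym (proj₁ p) (proj₁ q)
        }
      ; triangle = λ p q r → X.triangle (proj₁ p) (proj₁ q) (proj₁ r)
      }
    }
    where
    module X = BooleanMetricSpace X
    module M = IsGeneralMetric X.isMetric

  module _ {x ℓ} (X : BooleanMetricSpace B x ℓ) where

    private module X = BooleanMetricSpace X

    IsConvexCombination : ∀ {n} → Vector X.Carrier n → Vector B.Carrier n →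
                          X.Carrier → Set ℓ₁
    IsConvexCombination xs a z = ∀ i → a i B.∧ X.d z (xs i) B.≈ B.⊥

    -- Families are nonempty, so the empty space is convex even when B is
    -- trivial.
    IsConvex : Set (c ⊔ ℓ₁ ⊔ ℓ₂ ⊔ x)
    IsConvex = ∀ n (xs : Vector X.Carrier (suc n)) (a : Vector B.Carrier (suc n)) →
               IsPartition B a → ∃ (IsConvexCombination xs a)

    -- The list S may be empty, which forces X to be empty.
    IsFinitelyGenerated : Set (c ⊔ ℓ₁ ⊔ ℓ₂ ⊔ x ⊔ ℓ)
    IsFinitelyGenerated =
      ∃ λ (S : List X.Carrier) → ∀ z →
      ∃ λ (n : ℕ) →
      ∃ λ (xs : Vector X.Carrier (suc n)) →
      ∃ λ (a : Vector B.Carrier (suc n)) →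
        (∀ i → _∈_ X.setoid (xs i) S) × IsPartition B a × IsConvexCombination xs a z

    record IsCFG : Set (c ⊔ ℓ₁ ⊔ ℓ₂ ⊔ x ⊔ ℓ) where
      field
        convex            : IsConvex
        finitelyGenerated : IsFinitelyGenerated

{-# OPTIONS --safe #-}

-- Say that x and y agree on k ∈ B when k ∧ d(x,y) = ⊥; a map is contractive iff
-- it preserves agreement on every k. For a generator s, let the weight of s at z
-- be the supremum of those k for which some u ∈ U agrees with z on k while F(u)
-- agrees with s on k. Going through a finite list of generators s₁, …, sₘ, let
-- F′(z) be s₁ on the weight of s₁, elsewhere s₂ on the weight of s₂, and so on,
-- and z itself where no weight applies. The weights at two points that agree on k
-- coincide below k, so F′ is contractive. For u ∈ U, every s agrees with F(u) on
-- its weight at u, and these weights cover ⊤ because F(u) is a convex combination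
-- of the generators; hence F′(u) = F(u).
module Submission where

open import Defs
open import Data.Fin.Patterns using (0F; 1F)
open import Data.List.Base using (List; []; _∷_)
open import Data.List.Membership.Setoid using (_∈_)
open import Data.List.Relation.Unary.Any using (here; there)
open import Data.Product.Base using (Σ; ∃; _×_; _,_; proj₁; proj₂)
open import Data.Vec.Functional as Vector using ()
open import Level using (_⊔_; Lift; lift)
open import Relation.Binary.Lattice.Bundles using (BooleanAlgebra)
open import Relation.Binary.PropositionalEquality.Core as ≡ using (_≢_)
open import Relation.Nullary.Negation.Core using (contradiction)
open import Relation.Unary using (Pred)
import Relation.Binary.Lattice.Properties.HeytingAlgebra as HeytingAlgebraProperties
import Relation.Binary.Lattice.Properties.MeetSemilattice as MeetSemilatticeProperties

module BooleanAlgebraProperties {c ℓ₁ ℓ₂} (B : BooleanAlgebra c ℓ₁ ℓ₂) where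

  open BooleanAlgebra B
  open HeytingAlgebraProperties heytingAlgebra using (swap-transpose-⇨)
  open MeetSemilatticeProperties meetSemilattice using (∧-comm)

  ≤⊥⇒≈⊥ : ∀ {x} → x ≤ ⊥ → x ≈ ⊥
  ≤⊥⇒≈⊥ x≤⊥ = antisym x≤⊥ (minimum _)

  -- Here `x ⇨ y` unfolds to `¬ x ∨ y`, so the laws of complements are instances of the Heyting
  -- adjunction.
  ¬x∧x≤⊥ : ∀ {x} → ¬ x ∧ x ≤ ⊥
  ¬x∧x≤⊥ = transpose-∧ (x≤x∨y _ _)

  x∧¬x≤⊥ : ∀ {x} → x ∧ ¬ x ≤ ⊥
  x∧¬x≤⊥ = trans (reflexive (∧-comm _ _)) ¬x∧x≤⊥

  transpose-¬ : ∀ {x y} → x ∧ y ≤ ⊥ → x ≤ ¬ y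
  transpose-¬ x∧y≤⊥ = trans (transpose-⇨ x∧y≤⊥) (∨-least refl (minimum _))

  ⊤≤¬x∨x : ∀ {x} → ⊤ ≤ ¬ x ∨ x
  ⊤≤¬x∨x = transpose-⇨ (x∧y≤y _ _)

  by-cases : ∀ {x t} b → x ∧ b ≤ t → x ∧ ¬ b ≤ t → x ≤ t
  by-cases b on-b on-¬b =
    trans (∧-greatest refl (trans (maximum _) ⊤≤¬x∨x))
      (trans (reflexive (∧-comm _ _))
        (transpose-∧ (∨-least (swap-transpose-⇨ on-¬b) (swap-transpose-⇨ on-b))))

  x,¬x-isPartition : ∀ x → IsPartition B (x Vector.∷ ¬ x Vector.∷ Vector.[])
  x,¬x-isPartition x = record
    { disjoint = disjoint
    ; supremum = (λ _ _ → maximum _) , λ t bound →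
        trans ⊤≤¬x∨x (∨-least (bound _ (1F , Eq.refl)) (bound _ (0F , Eq.refl)))
    }
    where
    disjoint : ∀ {i j} → i ≢ j →
               let a = x Vector.∷ ¬ x Vector.∷ Vector.[] in a i ∧ a j ≈ ⊥
    disjoint {0F} {0F} i≢i = contradiction ≡.refl i≢i
    disjoint {0F} {1F} _   = ≤⊥⇒≈⊥ x∧¬x≤⊥
    disjoint {1F} {0F} _   = ≤⊥⇒≈⊥ ¬x∧x≤⊥
    disjoint {1F} {1F} i≢i = contradiction ≡.refl i≢i

module Agreement {c ℓ₁ ℓ₂} {B : BooleanAlgebra c ℓ₁ ℓ₂}
                 {x ℓ} (X : BooleanMetricSpace B x ℓ) where

  private module B = BooleanAlgebra B
  open BooleanAlgebraProperties B
  open HeytingAlgebraProperties B.heytingAlgebra using (∧-distribˡ-∨-≤)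
  open MeetSemilatticeProperties B.meetSemilattice using (∧-monotonic)
  open BooleanMetricSpace X

  infix 4 _≈[_]_
  -- This is the condition imposed by one coefficient in `IsConvexCombination`, so each component of
  -- a convex combination is already an agreement.
  _≈[_]_ : Carrier → B.Carrier → Carrier → Set ℓ₁
  p ≈[ k ] q = k B.∧ d p q B.≈ B.⊥

  -- With the converse below, the regions of agreement of `p` and `q` form the principal ideal of
  -- `¬ d p q`; restricting, gluing and taking suprema of regions thus become facts about the order.
  ≈[]⇒≤¬d : ∀ {k p q} → p ≈[ k ] q → k B.≤ B.¬ d p q
  ≈[]⇒≤¬d p≈q = transpose-¬ (B.reflexive p≈q)

  ≤¬d⇒≈[] : ∀ {k p q} → k B.≤ B.¬ d p q → p ≈[ k ] q
  ≤¬d⇒≈[] k≤¬d = ≤⊥⇒≈⊥ (B.trans (∧-monotonic k≤¬d B.refl) ¬x∧x≤⊥)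

  ≈[]-antitone : ∀ {k l p q} → l B.≤ k → p ≈[ k ] q → p ≈[ l ] q
  ≈[]-antitone l≤k p≈q = ≤¬d⇒≈[] (B.trans l≤k (≈[]⇒≤¬d p≈q))

  ≈⇒≈[] : ∀ {k p q} → p ≈ q → p ≈[ k ] q
  ≈⇒≈[] p≈q = ≤⊥⇒≈⊥ (B.trans (B.x∧y≤y _ _) (B.reflexive (≈⇒0 p≈q)))

  ≈[]-refl : ∀ {k p} → p ≈[ k ] p
  ≈[]-refl = ≈⇒≈[] EqC.refl

  ≈[]-sym : ∀ {k p q} → p ≈[ k ] q → q ≈[ k ] p
  ≈[]-sym p≈q =
    ≤⊥⇒≈⊥ (B.trans (∧-monotonic B.refl (B.reflexive (sym _ _))) (B.reflexive p≈q))

  ≈[]-trans : ∀ {k p q r} → p ≈[ k ] q → q ≈[ k ] r → p ≈[ k ] r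
  ≈[]-trans {k} {p} {q} {r} p≈q q≈r = ≤⊥⇒≈⊥
    (B.trans (∧-monotonic B.refl (triangle p q r))
      (B.trans (∧-distribˡ-∨-≤ k (d p q) (d q r))
        (B.∨-least (B.reflexive p≈q) (B.reflexive q≈r))))

  ≈[]-by-cases : ∀ {k p q} b → p ≈[ k B.∧ b ] q → p ≈[ k B.∧ B.¬ b ] q → p ≈[ k ] q
  ≈[]-by-cases b on-b on-¬b = ≤¬d⇒≈[] (by-cases b (≈[]⇒≤¬d on-b) (≈[]⇒≤¬d on-¬b))

  ≈[]-supremum : ∀ {i} {P : Pred B.Carrier i} {s p q} → IsSupremum B P s →
                 (∀ k → P k → p ≈[ k ] q) → p ≈[ s ] q
  ≈[]-supremum (_ , least) agree = ≤¬d⇒≈[] (least _ λ k k∈P → ≈[]⇒≤¬d (agree k k∈P))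

  ≈[⊤]⇒≈ : ∀ {p q} → p ≈[ B.⊤ ] q → p ≈ q
  ≈[⊤]⇒≈ p≈q =
    0⇒≈ (≤⊥⇒≈⊥ (B.trans (B.∧-greatest (B.maximum _) B.refl) (B.reflexive p≈q)))

module _ {c ℓ₁ ℓ₂} {B : BooleanAlgebra c ℓ₁ ℓ₂} {x ℓ y ℓ′}
         (X : BooleanMetricSpace B x ℓ) (Y : BooleanMetricSpace B y ℓ′)
         {f : BooleanMetricSpace.Carrier X → BooleanMetricSpace.Carrier Y} where

  private
    module B = BooleanAlgebra B
    module X where
      open BooleanMetricSpace X public
      open Agreement X public
    module Y where
      open BooleanMetricSpace Y public
      open Agreement Y public
  open BooleanAlgebraProperties B
  open MeetSemilatticeProperties B.meetSemilattice using (∧-comm; ∧-monotonic)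

  contractive⇒≈[]-preserving : IsContractive X Y f →
                               ∀ {k p q} → p X.≈[ k ] q → f p Y.≈[ k ] f q
  contractive⇒≈[]-preserving f-contr p≈q =
    ≤⊥⇒≈⊥ (B.trans (∧-monotonic B.refl (f-contr _ _)) (B.reflexive p≈q))

  -- Below `X.d p q` the bound is trivial. Its complement is the largest region where `p` and `q`
  -- agree, so there the distance of the images vanishes.
  ≈[]-preserving⇒contractive : (∀ {k p q} → p X.≈[ k ] q → f p Y.≈[ k ] f q) →
                               IsContractive X Y f
  ≈[]-preserving⇒contractive f-pres p q = by-cases (X.d p q) (B.x∧y≤y _ _)
    (B.trans (B.reflexive (∧-comm _ _))
      (B.trans (B.reflexive (f-pres (X.≤¬d⇒≈[] B.refl))) (B.minimum _)))

module Splicing {c ℓ₁ ℓ₂} {B : BooleanAlgebra c ℓ₁ ℓ₂} {x ℓ}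
                (X : BooleanMetricSpace B x ℓ) (convex : IsConvex X) where

  private module B = BooleanAlgebra B
  open BooleanAlgebraProperties B
  open MeetSemilatticeProperties B.meetSemilattice using (∧-monotonic)
  open BooleanMetricSpace X
  open Agreement X

  private
    splicing : ∀ b p q → ∃ (IsConvexCombination X (p Vector.∷ q Vector.∷ Vector.[])
                                                  (b Vector.∷ B.¬ b Vector.∷ Vector.[]))
    splicing b p q = convex 1 _ _ (x,¬x-isPartition b)

  splice : B.Carrier → Carrier → Carrier → Carrier
  splice b p q = proj₁ (splicing b p q)

  splice-≈[b] : ∀ b p q → splice b p q ≈[ b ] p
  splice-≈[b] b p q = proj₂ (splicing b p q) 0F

  splice-≈[¬b] : ∀ b p q → splice b p q ≈[ B.¬ b ] q
  splice-≈[¬b] b p q = proj₂ (splicing b p q) 1F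

  splice-cong : ∀ {k b b′ p p′ q q′} → k B.∧ b B.≤ b′ → k B.∧ b′ B.≤ b →
                p ≈[ k ] p′ → q ≈[ k ] q′ → splice b p q ≈[ k ] splice b′ p′ q′
  splice-cong {k} {b} {b′} kb≤b′ kb′≤b p≈p′ q≈q′ = ≈[]-by-cases b
    (≈[]-trans (≈[]-antitone (B.x∧y≤y _ _) (splice-≈[b] _ _ _))
      (≈[]-trans (≈[]-antitone (B.x∧y≤x _ _) p≈p′)
        (≈[]-sym (≈[]-antitone kb≤b′ (splice-≈[b] _ _ _)))))
    (≈[]-trans (≈[]-antitone (B.x∧y≤y _ _) (splice-≈[¬b] _ _ _))
      (≈[]-trans (≈[]-antitone (B.x∧y≤x _ _) q≈q′)
        (≈[]-sym (≈[]-antitone k¬b≤¬b′ (splice-≈[¬b] _ _ _)))))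
    where
    k¬b≤¬b′ : k B.∧ B.¬ b B.≤ B.¬ b′
    -- The meet of `k ∧ ¬ b` with `b′` lies below `b`, by `kb′≤b`, and below `¬ b`.
    k¬b≤¬b′ = transpose-¬ (B.trans
      (B.∧-greatest
        (B.trans (∧-monotonic (B.x∧y≤x _ _) B.refl) kb′≤b)
        (B.trans (B.x∧y≤x _ _) (B.x∧y≤y _ _)))
      x∧¬x≤⊥)

  spliceAll : (Carrier → B.Carrier) → List Carrier → Carrier → Carrier
  spliceAll g []      z = z
  spliceAll g (s ∷ S) z = splice (g s) s (spliceAll g S z)

  spliceAll-cong : ∀ {k g g′ z z′} S →
                   (∀ s → k B.∧ g s B.≤ g′ s) → (∀ s → k B.∧ g′ s B.≤ g s) →
                   z ≈[ k ] z′ → spliceAll g S z ≈[ k ] spliceAll g′ S z′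
  spliceAll-cong []      kg≤g′ kg′≤g z≈z′ = z≈z′
  spliceAll-cong (s ∷ S) kg≤g′ kg′≤g z≈z′ =
    splice-cong (kg≤g′ s) (kg′≤g s) ≈[]-refl (spliceAll-cong S kg≤g′ kg′≤g z≈z′)

  -- The hypotheses make `g t` the largest region where `p` agrees with `t`. Hence an entry that
  -- precedes `s` and takes priority over it still supplies a value agreeing with `p`, and once `s`
  -- is reached, `k` lies inside its region.
  spliceAll-≈[] : ∀ {g z p k s S} →
                  (∀ t → p ≈[ g t ] t) → (∀ {l t} → p ≈[ l ] t → l B.≤ g t) →
                  _∈_ setoid s S → p ≈[ k ] s → spliceAll g S z ≈[ k ] p
  spliceAll-≈[] p≈[g] g-max (here s≈t) p≈s =
    ≈[]-trans (≈[]-antitone (g-max p≈t) (splice-≈[b] _ _ _)) (≈[]-sym p≈t)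
    where p≈t = ≈[]-trans p≈s (≈⇒≈[] s≈t)
  spliceAll-≈[] {g} {S = t ∷ _} p≈[g] g-max (there s∈S) p≈s = ≈[]-by-cases (g t)
    (≈[]-antitone (B.x∧y≤y _ _)
      (≈[]-trans (splice-≈[b] _ _ _) (≈[]-sym (p≈[g] t))))
    (≈[]-trans (≈[]-antitone (B.x∧y≤y _ _) (splice-≈[¬b] _ _ _))
      (≈[]-antitone (B.x∧y≤x _ _) (spliceAll-≈[] p≈[g] g-max s∈S p≈s)))

module Extension
  {c ℓ₁ ℓ₂ w ℓ u v} (B : BooleanAlgebra c ℓ₁ ℓ₂)
  (complete : IsComplete B (c ⊔ ℓ₁ ⊔ w ⊔ u))
  (W : BooleanMetricSpace B w ℓ) (isCFG : IsCFG W)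
  (U : Pred (BooleanMetricSpace.Carrier W) u)
  (V : Pred (BooleanMetricSpace.Carrier W) v)
  (F : Σ (BooleanMetricSpace.Carrier W) U → Σ (BooleanMetricSpace.Carrier W) V)
  (F-contractive : IsContractive (subspace W U) (subspace W V) F)
  where

  private module B = BooleanAlgebra B
  open BooleanMetricSpace W
  open Agreement W
  open IsCFG isCFG
  open MeetSemilatticeProperties B.meetSemilattice using (∧-comm)
  open Splicing W convex

  F-≈[] : ∀ {k} p q → proj₁ p ≈[ k ] proj₁ q → proj₁ (F p) ≈[ k ] proj₁ (F q)
  F-≈[] p q =
    contractive⇒≈[]-preserving (subspace W U) (subspace W V) {F} F-contractive
      {p = p} {q}

  Witnessed : Carrier → Carrier → Pred B.Carrier (c ⊔ ℓ₁ ⊔ w ⊔ u)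
  Witnessed z s k =
    -- `Lift` brings the predicate to the level at which `B` is assumed complete.
    Lift c (∃ λ (p : Σ Carrier U) → z ≈[ k ] proj₁ p × proj₁ (F p) ≈[ k ] s)

  weight : Carrier → Carrier → B.Carrier
  weight z s = proj₁ (complete (Witnessed z s))

  weight-isSupremum : ∀ z s → IsSupremum B (Witnessed z s) (weight z s)
  weight-isSupremum z s = proj₂ (complete (Witnessed z s))

  -- Meeting with `k` has a right adjoint, so it suffices to bound `l ∧ k` for each witnessed `l`;
  -- the point of `U` that serves `z` on `l` serves `z′` on `l ∧ k`.
  weight-local : ∀ {k z z′} → z ≈[ k ] z′ → ∀ s → k B.∧ weight z s B.≤ weight z′ s
  weight-local {k} {z} {z′} z≈z′ s =
    B.trans (B.reflexive (∧-comm _ _))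
      (B.transpose-∧ (proj₂ (weight-isSupremum z s) _ λ where
        l (lift (p , z≈p , Fp≈s)) → B.transpose-⇨
          (proj₁ (weight-isSupremum z′ s) _ (lift (p
            , ≈[]-trans (≈[]-sym (≈[]-antitone (B.x∧y≤y _ _) z≈z′))
                        (≈[]-antitone (B.x∧y≤x _ _) z≈p)
            , ≈[]-antitone (B.x∧y≤x _ _) Fp≈s)))))

  -- Contractivity of `F` makes all witnesses `q` compatible: where `q` agrees with `p`, `F q`
  -- agrees with `F p`. The next lemma, with `p` as its own witness, shows that this region is the
  -- largest possible.
  F-≈[weight] : ∀ p s → proj₁ (F p) ≈[ weight (proj₁ p) s ] s
  F-≈[weight] p s = ≈[]-supremum (weight-isSupremum (proj₁ p) s) λ where
    k (lift (q , p≈q , Fq≈s)) → ≈[]-trans (F-≈[] p q p≈q) Fq≈s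

  F-≈[]⇒≤weight : ∀ p {k s} → proj₁ (F p) ≈[ k ] s → k B.≤ weight (proj₁ p) s
  F-≈[]⇒≤weight p Fp≈s =
    proj₁ (weight-isSupremum _ _) _ (lift (p , ≈[]-refl , Fp≈s))

  F′ : Carrier → Carrier
  F′ z = spliceAll (weight z) (proj₁ finitelyGenerated) z

  F′-contractive : IsContractive W W F′
  F′-contractive = ≈[]-preserving⇒contractive W W λ z≈z′ →
    spliceAll-cong (proj₁ finitelyGenerated)
      (weight-local z≈z′) (weight-local (≈[]-sym z≈z′)) z≈z′

  F′-extends : ∀ p → F′ (proj₁ p) ≈ proj₁ (F p)
  F′-extends p with proj₂ finitelyGenerated (proj₁ (F p))
  ... | _ , xs , a , xs∈S , a-partition , combination =
    -- The coefficients of `F p` have supremum `⊤`, so agreement on each `a i` suffices; there `F p`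
    -- agrees with the generator `xs i`.
    ≈[⊤]⇒≈ (≈[]-supremum (IsPartition.supremum a-partition) λ where
      k (i , aᵢ≈k) → ≈[]-antitone (B.reflexive (B.Eq.sym aᵢ≈k))
        (spliceAll-≈[] (F-≈[weight] p) (F-≈[]⇒≤weight p) (xs∈S i) (combination i)))

theorem4 : ∀ {c ℓ₁ ℓ₂ w ℓ u v} (B : BooleanAlgebra c ℓ₁ ℓ₂) →
    IsComplete B (c ⊔ ℓ₁ ⊔ w ⊔ u) →
    (W : BooleanMetricSpace B w ℓ) → IsCFG W →
    let open BooleanMetricSpace W in
    (U : Pred Carrier u) (V : Pred Carrier v)
    (F : Σ Carrier U → Σ Carrier V) →
    IsContractive (subspace W U) (subspace W V) F →
    Σ (Carrier → Carrier) λ F′ →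
    IsContractive W W F′ × (∀ (p : Σ Carrier U) → F′ (proj₁ p) ≈ proj₁ (F p))
theorem4 B complete W isCFG U V F F-contractive = F′ , F′-contractive , F′-extends
  where open Extension B complete W isCFG U V F F-contractive
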